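{- The scheme $\sim(\sim(\alpha\vee\beta)\vee\gamma)\rightarrow_{d}(\sim(\sim\alpha\vee\gamma)\vee\sim(\sim\beta\vee\gamma))$ is not provable in the axiom system $\mathrm{C}$; that is, there are formulas $\alpha,\beta,\gamma$ such that $\sim(\sim(\alpha\vee\beta)\vee\gamma)\rightarrow_{d}(\sim(\sim\alpha\vee\gamma)\vee\sim(\sim\beta\vee\gamma))$ is not a theorem of $\mathrm{C}$.
   Context: Formulas are built from a countably infinite set of propositional variables using the unary connective $\sim$ (negation) and the binary connectives $\vee$ (disjunction), $\rightarrow_{d}$ (discussive implication), $\wedge_{d}$ (discussive conjunction), all treated as primitive. $\sim$ binds more tightly than the binary connectives. The axiom system $\mathrm{C}$ has as its sole rule modus ponens for $\rightarrow_{d}$ (from $\alpha$ and $\alpha\rightarrow_{d}\beta$ infer $\beta$), and as axioms all instances (for arbitrary formulas $\alpha,\beta,\gamma$) of the following schemes: C1: $\alpha\rightarrow_{d}(\beta\rightarrow_{d}\alpha)$. C2: $(\alpha\rightarrow_{d}(\beta\rightarrow_{d}\gamma))\rightarrow_{d}((\alpha\rightarrow_{d}\beta)\rightarrow_{d}(\alpha\rightarrow_{d}\gamma))$. C3: $(\alpha\wedge_{d}\beta)\rightarrow_{d}\alpha$. C4: $(\alpha\wedge_{d}\beta)\rightarrow_{d}\beta$. C5: $\alpha\rightarrow_{d}(\beta\rightarrow_{d}(\alpha\wedge_{d}\beta))$. C6: $\alpha\rightarrow_{d}(\alpha\vee\beta)$. C7: $\beta\rightarrow_{d}(\alpha\vee\beta)$.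 C8: $(\alpha\rightarrow_{d}\gamma)\rightarrow_{d}((\beta\rightarrow_{d}\gamma)\rightarrow_{d}((\alpha\vee\beta)\rightarrow_{d}\gamma))$. C9: $\alpha\vee(\alpha\rightarrow_{d}\beta)$. C10: $\sim(\sim\alpha\wedge_{d}(\sim\sim\alpha\wedge_{d}\sim(\alpha\vee\sim\alpha)))$. C11: $\sim(\sim\alpha\wedge_{d}(\sim\beta\wedge_{d}\sim(\alpha\vee\beta)))\rightarrow_{d}\sim(\sim\alpha\wedge_{d}(\sim\beta\wedge_{d}(\sim\gamma\wedge_{d}\sim(\alpha\vee(\beta\vee\gamma)))))$. C12: $\sim(\sim\alpha\wedge_{d}(\sim\beta\wedge_{d}(\sim\gamma\wedge_{d}\sim(\alpha\vee(\beta\vee\gamma)))))\rightarrow_{d}\sim(\sim\alpha\wedge_{d}(\sim\gamma\wedge_{d}(\sim\beta\wedge_{d}\sim(\alpha\vee(\gamma\vee\beta)))))$. C13: $\sim(\sim\alpha\wedge_{d}(\sim\beta\wedge_{d}(\sim\gamma\wedge_{d}\sim(\alpha\vee(\beta\vee\gamma)))))\rightarrow_{d}((\alpha\vee(\beta\vee\sim\gamma))\rightarrow_{d}(\alpha\vee\beta))$. C14: $\sim(\sim\alpha\wedge_{d}\sim\beta)\rightarrow_{d}(\alpha\vee\beta)$. C15: $(\alpha\vee(\beta\vee\sim\beta))\rightarrow_{d}\sim(\sim\alpha\wedge_{d}\sim(\beta\vee\sim\beta))$. A theorem of $\mathrm{C}$ is a formula derivable from these axioms by finitely many applications of modus ponens.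 A scheme is said to be unprovable in $\mathrm{C}$ if at least one of its instances is not a theorem of $\mathrm{C}$. -}

module Defs where

open import Data.Nat using (ℕ)

infix  8 ∼_
infix  6 _∨_ _∧ᵈ_
infix  5 _→ᵈ_
infix  3 ⊢_

data Formula : Set where
  var  : ℕ → Formula
  ∼_   : Formula → Formula
  _∨_  : Formula → Formula → Formula
  _→ᵈ_ : Formula → Formula → Formula
  _∧ᵈ_ : Formula → Formula → Formula

data Axiom : Formula → Set where
  C1  : ∀ α β → Axiom (α →ᵈ (β →ᵈ α))
  C2  : ∀ α β γ → Axiom ((α →ᵈ (β →ᵈ γ)) →ᵈ ((α →ᵈ β) →ᵈ (α →ᵈ γ)))
  C3  : ∀ α β → Axiom ((α ∧ᵈ β) →ᵈ α)
  C4  : ∀ α β → Axiom ((α ∧ᵈ β) →ᵈ β)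
  C5  : ∀ α β → Axiom (α →ᵈ (β →ᵈ (α ∧ᵈ β)))
  C6  : ∀ α β → Axiom (α →ᵈ (α ∨ β))
  C7  : ∀ α β → Axiom (β →ᵈ (α ∨ β))
  C8  : ∀ α β γ → Axiom ((α →ᵈ γ) →ᵈ ((β →ᵈ γ) →ᵈ ((α ∨ β) →ᵈ γ)))
  C9  : ∀ α β → Axiom (α ∨ (α →ᵈ β))
  C10 : ∀ α → Axiom (∼ (∼ α ∧ᵈ (∼ (∼ α) ∧ᵈ ∼ (α ∨ ∼ α))))
  C11 : ∀ α β γ → Axiom
          (∼ (∼ α ∧ᵈ (∼ β ∧ᵈ ∼ (α ∨ β)))
            →ᵈ ∼ (∼ α ∧ᵈ (∼ β ∧ᵈ (∼ γ ∧ᵈ ∼ (α ∨ (β ∨ γ))))))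
  C12 : ∀ α β γ → Axiom
          (∼ (∼ α ∧ᵈ (∼ β ∧ᵈ (∼ γ ∧ᵈ ∼ (α ∨ (β ∨ γ)))))
            →ᵈ ∼ (∼ α ∧ᵈ (∼ γ ∧ᵈ (∼ β ∧ᵈ ∼ (α ∨ (γ ∨ β))))))
  C13 : ∀ α β γ → Axiom
          (∼ (∼ α ∧ᵈ (∼ β ∧ᵈ (∼ γ ∧ᵈ ∼ (α ∨ (β ∨ γ)))))
            →ᵈ ((α ∨ (β ∨ ∼ γ)) →ᵈ (α ∨ β)))
  C14 : ∀ α β → Axiom (∼ (∼ α ∧ᵈ ∼ β) →ᵈ (α ∨ β))
  C15 : ∀ α β → Axiom ((α ∨ (β ∨ ∼ β)) →ᵈ ∼ (∼ α ∧ᵈ ∼ (β ∨ ∼ β)))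

data ⊢_ : Formula → Set where
  axiom        : ∀ {α} → Axiom α → ⊢ α
  modus-ponens : ∀ {α β} → ⊢ α → ⊢ (α →ᵈ β) → ⊢ β

{-# OPTIONS --safe #-}
-- The positive connectives of C are classical, while the truth value of ∼ φ may
-- depend on the syntactic form of φ.  Take the two-valued valuation in which all
-- variables are true and ∼ behaves classically, except that ∼ (φ ∨ ψ) is true not
-- only when ∼ φ and ∼ ψ are, but also whenever φ ∨ ψ has the form
-- ∼ (α ∨ β) ∨ var k.  The disjunctions α ∨ (β ∨ γ) and β ∨ ∼ β whose negations
-- occur in C10–C13 and C15 never have this form; in the remaining one, ∼ (α ∨ β)
-- in C11, making it true only weakens the antecedent.  So all axioms hold.
module Submission where

open import Defs
open import Data.Bool using (Bool; true; false; not)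
  renaming (_∨_ to _or_; _∧_ to _and_)
open import Data.Product using (∃-syntax; _,_)
open import Function using (case_of_)
open import Relation.Binary.PropositionalEquality using (_≡_; refl)
open import Relation.Nullary using (¬_)

infixr 4 _implies_

_implies_ : Bool → Bool → Bool
x implies y = not x or y

-- The right disjunct comes first, so that exceptional ψ φ computes as soon as
-- ψ is known not to be a variable.
exceptional : Formula → Formula → Bool
exceptional (var _) (∼ (_ ∨ _)) = true
exceptional _       _           = false

-- The value of `∼ φ` gets its own recursion on `φ`: for a disjunction it depends on the negations
-- of the disjuncts, which are not subformulas.
value value∼ : Formula → Bool

value (var _)  = true
value (∼ φ)    = value∼ φ
value (φ ∨ ψ)  = value φ or value ψ
value (φ →ᵈ ψ) = value φ implies value ψ
value (φ ∧ᵈ ψ) = value φ and value ψ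

value∼ (var _)  = false
value∼ (∼ φ)    = not (value∼ φ)
value∼ (φ ∨ ψ)  = exceptional ψ φ or (value∼ φ and value∼ ψ)
value∼ (φ →ᵈ ψ) = not (value φ implies value ψ)
value∼ (φ ∧ᵈ ψ) = not (value φ and value ψ)

excluded-middle-Bool : ∀ x → x or not x ≡ true
excluded-middle-Bool false = refl
excluded-middle-Bool true  = refl

excluded-middle-or : ∀ e x y m n → x or m ≡ true → y or n ≡ true →
  (x or y) or (e or (m and n)) ≡ true
excluded-middle-or _     true  _     _    _    _ _ = refl
excluded-middle-or _     false true  _    _    _ _ = refl
excluded-middle-or true  false false _    _    _ _ = refl
excluded-middle-or false false false true true _ _ = refl

-- The exception only makes more negations true, so this half of classical negation survives,
-- although `φ` and `∼ φ` can both be true. C13 and C14 rest on it.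
excluded-middle : ∀ φ → value φ or value∼ φ ≡ true
excluded-middle (var _)  = refl
excluded-middle (∼ φ)    = excluded-middle-Bool (value∼ φ)
excluded-middle (φ ∨ ψ)  =
  excluded-middle-or (exceptional ψ φ) (value φ) (value ψ) (value∼ φ) (value∼ ψ)
    (excluded-middle φ) (excluded-middle ψ)
excluded-middle (φ →ᵈ ψ) = excluded-middle-Bool (value φ implies value ψ)
excluded-middle (φ ∧ᵈ ψ) = excluded-middle-Bool (value φ and value ψ)

-- In the tautologies below x, y, z stand for the values of α, β, γ, then m, n, o
-- for those of ∼ α, ∼ β, ∼ γ, and d, e for exceptional on the disjunctions involved;
-- p is the value of a compound whose structure does not matter.

c1 : ∀ x y → (x implies y implies x) ≡ true
c1 false _     = refl
c1 true  false = refl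
c1 true  true  = refl

c2 : ∀ x y z →
  ((x implies y implies z) implies (x implies y) implies x implies z) ≡ true
c2 false _     _     = refl
c2 true  false false = refl
c2 true  false true  = refl
c2 true  true  false = refl
c2 true  true  true  = refl

c3 : ∀ x y → (x and y implies x) ≡ true
c3 false _     = refl
c3 true  false = refl
c3 true  true  = refl

c4 : ∀ x y → (x and y implies y) ≡ true
c4 false _     = refl
c4 true  false = refl
c4 true  true  = refl

c5 : ∀ x y → (x implies y implies x and y) ≡ true
c5 false _     = refl
c5 true  false = refl
c5 true  true  = refl

c6 : ∀ x y → (x implies x or y) ≡ true
c6 false _ = refl
c6 true  _ = refl

c7 : ∀ x y → (y implies x or y) ≡ true
c7 _     false = refl
c7 false true  = refl
c7 true  true  = refl

c8 : ∀ x y z →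
  ((x implies z) implies (y implies z) implies x or y implies z) ≡ true
c8 false false false = refl
c8 false true  false = refl
c8 true  _     false = refl
c8 false false true  = refl
c8 false true  true  = refl
c8 true  false true  = refl
c8 true  true  true  = refl

c9 : ∀ x y → x or (x implies y) ≡ true
c9 false _ = refl
c9 true  _ = refl

c10 : ∀ m p → not (m and (not m and p)) ≡ true
c10 false _ = refl
c10 true  _ = refl

c11 : ∀ d e m n o →
  (not (m and (n and (d or (m and n)))) implies
   not (m and (n and (o and (m and (e or (n and o))))))) ≡ true
c11 _     _ false _     _ = refl
c11 _     _ true  false _ = refl
c11 false _ true  true  _ = refl
c11 true  _ true  true  _ = refl

c12 : ∀ d e m n o →
  (not (m and (n and (o and (m and (d or (n and o)))))) implies
   not (m and (o and (n and (m and (e or (o and n))))))) ≡ true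
c12 _     _ false _     _     = refl
c12 _     _ true  false false = refl
c12 _     _ true  false true  = refl
c12 _     _ true  true  false = refl
c12 false _ true  true  true  = refl
c12 true  _ true  true  true  = refl

implies-true : ∀ x → (x implies true) ≡ true
implies-true false = refl
implies-true true  = refl

-- If `α` and `β` are false, excluded middle makes `∼ α` and `∼ β` true; the first premise then
-- rules out `∼ γ`, so the second fails.
c13 : ∀ e x y m n o → x or m ≡ true → y or n ≡ true →
  (not (m and (n and (o and (m and (e or (n and o)))))) implies
   x or (y or o) implies x or y) ≡ true
c13 _     true  _     _    _    _     _ _ = implies-true _
c13 _     false true  _    _    _     _ _ = implies-true _
c13 _     false false true true false _ _ = refl
c13 false false false true true true  _ _ = refl
c13 true  false false true true true  _ _ = refl

c14 : ∀ x y m n → x or m ≡ true → y or n ≡ true →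
  (not (m and n) implies x or y) ≡ true
c14 false false true  true  _ _ = refl
c14 false true  false _     _ _ = refl
c14 false true  true  false _ _ = refl
c14 false true  true  true  _ _ = refl
c14 true  _     false _     _ _ = refl
c14 true  _     true  false _ _ = refl
c14 true  _     true  true  _ _ = refl

-- Here `n and not n` is the value of `∼ (β ∨ ∼ β)`, which is not exceptional and hence false.
c15 : ∀ p m n → (p implies not (m and (n and not n))) ≡ true
c15 false _     _     = refl
c15 true  false _     = refl
c15 true  true  false = refl
c15 true  true  true  = refl

axiom-sound : ∀ {φ} → Axiom φ → value φ ≡ true
axiom-sound (C1 α β)    = c1 (value α) (value β)
axiom-sound (C2 α β γ)  = c2 (value α) (value β) (value γ)
axiom-sound (C3 α β)    = c3 (value α) (value β)
axiom-sound (C4 α β)    = c4 (value α) (value β)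
axiom-sound (C5 α β)    = c5 (value α) (value β)
axiom-sound (C6 α β)    = c6 (value α) (value β)
axiom-sound (C7 α β)    = c7 (value α) (value β)
axiom-sound (C8 α β γ)  = c8 (value α) (value β) (value γ)
axiom-sound (C9 α β)    = c9 (value α) (value β)
axiom-sound (C10 α)     = c10 (value∼ α) (value∼ (α ∨ ∼ α))
axiom-sound (C11 α β γ) =
  c11 (exceptional β α) (exceptional γ β) (value∼ α) (value∼ β) (value∼ γ)
axiom-sound (C12 α β γ) =
  c12 (exceptional γ β) (exceptional β γ) (value∼ α) (value∼ β) (value∼ γ)
axiom-sound (C13 α β γ) =
  c13 (exceptional γ β) (value α) (value β) (value∼ α) (value∼ β) (value∼ γ)
    (excluded-middle α) (excluded-middle β)
axiom-sound (C14 α β)   =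
  c14 (value α) (value β) (value∼ α) (value∼ β)
    (excluded-middle α) (excluded-middle β)
axiom-sound (C15 α β)   =
  c15 (value (α ∨ (β ∨ ∼ β))) (value∼ α) (value∼ β)

implies-elim : ∀ {x y} → x ≡ true → (x implies y) ≡ true → y ≡ true
implies-elim refl q = q

sound : ∀ {φ} → ⊢ φ → value φ ≡ true
sound (axiom a)          = axiom-sound a
sound (modus-ponens p q) = implies-elim (sound p) (sound q)

proposition2p10 : ∃[ α ] ∃[ β ] ∃[ γ ]
    ¬ (⊢ (∼ (∼ (α ∨ β) ∨ γ) →ᵈ (∼ (∼ α ∨ γ) ∨ ∼ (∼ β ∨ γ))))
-- The antecedent negates an exceptional disjunction, so it is true. Since `∼ var 0` and `∼ var 1`
-- do not negate disjunctions, the consequent is evaluated classically and is false.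
proposition2p10 = var 0 , var 1 , var 2 , λ p → case sound p of λ ()
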